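{- Let $G$ be a finite simple undirected graph of order $n\ge 3$ with degree sequence $d_1\le d_2\le\ldots\le d_n$ and minimum degree $\delta=d_1$, where $1\le\delta\le n-2$ (so that the terms $d_\delta$, $d_{\delta+1}$, $d_{\delta+2}$ are defined). If $\min\{d_\delta+d_{\delta+2},\,2d_{\delta+1}\}\ge n$, then $G$ is Hamiltonian.
   Context: Graphs are finite and undirected, with neither loops nor multiple edges. The order $n$ of $G$ is its number of vertices. The degree sequence $d_1\le d_2\le\ldots\le d_n$ lists the degrees of all $n$ vertices of $G$ in nondecreasing order, indexed from $1$; its first term $d_1$ is the minimum degree of $G$, denoted $\delta$. Thus $d_\delta$, $d_{\delta+1}$, $d_{\delta+2}$ are the $\delta$-th, $(\delta+1)$-th and $(\delta+2)$-th terms of this sequence. A graph is Hamiltonian if it contains a Hamilton cycle, that is, a simple spanning cycle. -}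

module Defs where

open import Data.Fin.Base using (Fin; fromℕ<)
open import Data.List.Base using (List; _∷_; _∷ʳ_; allFin; filter; length; lookup; tabulate)
open import Data.List.Membership.Propositional using (_∈_)
open import Data.List.Properties using (length-tabulate)
open import Data.List.Relation.Binary.Permutation.Propositional.Properties using (↭-length)
open import Data.List.Relation.Unary.Linked using (Linked)
open import Data.List.Relation.Unary.Unique.Propositional using (Unique)
open import Data.Nat.Base using (ℕ; suc; _≤_; z≤n; s≤s)
open import Data.Nat.Properties using (≤-decTotalOrder; ≤-trans; ≤-reflexive)
open import Data.Product.Base using (Σ-syntax)
open import Level using (0ℓ)
open import Relation.Binary.Core using (Rel)
open import Relation.Binary.Definitions using (Decidable; Irreflexive; Symmetric)
open import Relation.Binary.PropositionalEquality using (_≡_; sym; trans)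

import Data.List.Sort ≤-decTotalOrder as Sort

-- Vertices are adjacent or not according to a binary relation, which rules
-- out multiple edges; decidability makes degrees computable.
record Graph (n : ℕ) : Set₁ where
  field
    Adj    : Rel (Fin n) 0ℓ
    adj?   : Decidable Adj
    symm   : Symmetric Adj
    irrefl : Irreflexive _≡_ Adj

module _ {n : ℕ} (G : Graph n) where
  open Graph G

  degree : Fin n → ℕ
  degree v = length (filter (adj? v) (allFin n))

  degreeSequence : List ℕ
  degreeSequence = Sort.sort (tabulate degree)

  length-degreeSequence : length degreeSequence ≡ n
  length-degreeSequence =
    trans (↭-length (Sort.sort-↭ (tabulate degree))) (length-tabulate degree)

  -- The term dᵢ, indexed from 1.
  d : (i : ℕ) → .(1 ≤ i) → .(i ≤ n) → ℕ
  d (suc i) _ i<n =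
    lookup degreeSequence
      (fromℕ< (≤-trans i<n (≤-reflexive (sym length-degreeSequence))))

  minDegree : .(1 ≤ n) → ℕ
  minDegree 1≤n = d 1 (s≤s z≤n) 1≤n

  -- The closing edge is included by repeating the first vertex at the end
  -- of the list of vertices.
  record Cycle : Set where
    field
      first : Fin n
      rest  : List (Fin n)

    vertices : List (Fin n)
    vertices = first ∷ rest

    field
      long     : 3 ≤ length vertices
      simple   : Unique vertices
      adjacent : Linked Adj (vertices ∷ʳ first)

  Hamiltonian : Set
  Hamiltonian = Σ[ C ∈ Cycle ] (∀ v → v ∈ Cycle.vertices C)

{-# OPTIONS --safe #-}
-- Chvátal's theorem in closure form. Let H arise from G by adding edges, suppose H is not
-- complete, and let u, v be nonadjacent in H with maximal degree sum, k = deg u ≤ deg v. If the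
-- sum were below n, then at least k vertices would have degree at most k < n/2 and at least
-- n − k vertices would have degree below n − k. The first bound and n ≤ 2 d_{δ+1} give k = δ,
-- hence d_δ ≤ δ and d_{δ+2} ≥ n − δ. At most δ + 1 vertices have degree below d_{δ+2}, so the
-- second bound gives n − δ ≤ δ + 1 ≤ d_{δ+1}; as at most δ vertices have degree below d_{δ+1}, it
-- then gives n − δ ≤ δ, contradicting k < n/2. Hence deg u + deg v ≥ n, and by Bondy and Chvátal
-- H is Hamiltonian as soon as H + uv is.
module Submission where

open import Defs
open import Data.Empty using (⊥)
open import Data.Fin.Base using (Fin; zero; suc; toℕ)
open import Data.Fin.Properties using (_≟_; toℕ-fromℕ<)
open import Data.List.Base
  using (List; []; _∷_; [_]; _++_; _∷ʳ_; allFin; cartesianProduct; filter; length; lookup; map;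
         reverse; tabulate)
open import Data.List.Membership.Propositional using (_∈_; _∉_; lose)
open import Data.List.Membership.Propositional.Properties
  using (∈-allFin; ∈-cartesianProduct⁺; ∈-filter⁺)
open import Data.List.Properties
  using (filter-none; filter-some; length-tabulate; map-tabulate; unfold-reverse)
open import Data.List.Relation.Binary.Permutation.Propositional
  using (_↭_; ↭-sym; ↭-trans; ↭-reflexive; ↭⇒↭ₛ)
open import Data.List.Relation.Binary.Permutation.Propositional.Properties
  using (∈-resp-↭; filter-↭; ↭-length; ↭-reverse; ++-comm; ++⁺ˡ)
open import Data.List.Relation.Binary.Permutation.Setoid.Properties using (Unique-resp-↭)
open import Data.List.Relation.Binary.Sublist.Propositional using (⊆-refl)
open import Data.List.Relation.Binary.Sublist.Propositional.Properties using (length-mono-≤)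
open import Data.List.Relation.Binary.Sublist.Setoid.Properties using (filter⁺)
open import Data.List.Relation.Unary.All as All using (All; []; _∷_)
open import Data.List.Relation.Unary.All.Properties using (all-filter)
open import Data.List.Relation.Unary.AllPairs using (AllPairs; []; _∷_)
open import Data.List.Relation.Unary.Any using (Any; here; there)
open import Data.List.Relation.Unary.Linked using (Linked; [-]; _∷_)
open import Data.List.Relation.Unary.Linked.Properties using (Linked⇒AllPairs)
open import Data.List.Relation.Unary.Unique.Propositional using (Unique)
open import Data.List.Relation.Unary.Unique.Propositional.Properties using (allFin⁺)
open import Data.Nat.Base using (ℕ; zero; suc; _+_; _*_; _∸_; _⊓_; _≤_; _<_; z≤n; s≤s)
open import Data.Nat.Induction using (Acc; acc; <-wellFounded)
open import Data.Nat.Properties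
  using (≤-trans; m≤n⇒m≤n+o; +-monoʳ-≤; m≤m+n; m≤n+m; ≤-antisym; ≤-refl; ≤-reflexive; ≤-pred;
         ≤-total; ≤-totalOrder; ≤-<-trans; <-≤-trans; <-irrefl; <⇒≤; <⇒≱; ≮⇒≥; n≤1+n; m<n⇒m<1+n;
         m≤n⇒m≤1+n; _<?_; +-comm; +-suc; +-identityʳ; +-monoˡ-≤; +-monoʳ-<; +-cancelʳ-≤;
         *-cancelˡ-<; m∸n+n≡m; m≤n+o⇒m∸n≤o; m+n≤o⇒m≤o∸n; m⊓n≤m; m⊓n≤n; module ≤-Reasoning)
open import Data.List.Extrema ≤-totalOrder
  using (f[⊥]≤f[argmax]; argmax; argmax-all; f[xs]≤f[argmax])
open import Data.Nat.Tactic.RingSolver using (solve-∀)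
open import Data.Product.Base using (∃-syntax; _×_; _,_; proj₁; proj₂)
open import Data.Sum.Base as Sum using (_⊎_; inj₁; inj₂; [_,_]′)
open import Function.Base using (_∘_; id; case_of_)
open import Level using (Level; 0ℓ; _⊔_)
open import Relation.Binary.Core using (Rel)
open import Relation.Binary.Definitions using (Symmetric)
open import Relation.Binary.PropositionalEquality
  using (_≡_; _≢_; refl; sym; trans; cong; cong₂; subst; setoid)
open import Relation.Nullary using (¬_; yes; no; ¬?; _×-dec_; _⊎-dec_; contradiction)
open import Relation.Nullary.Decidable using (decidable-stable)
open import Relation.Unary using (Pred; Decidable; _⊆_)

import Data.List.Sort Data.Nat.Properties.≤-decTotalOrder as Sort

private variable
  a p q r b : Level
  A B : Set a

-- Counting

module _ {P : Pred A p} (P? : Decidable P) where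

  count : List A → ℕ
  count xs = length (filter P? xs)

  count-↭ : ∀ {xs ys} → xs ↭ ys → count xs ≡ count ys
  count-↭ = ↭-length ∘ filter-↭ P?

  length-≤-count+count-¬ : ∀ xs → length xs ≤ count xs + length (filter (¬? ∘ P?) xs)
  length-≤-count+count-¬ [] = z≤n
  length-≤-count+count-¬ (x ∷ xs) with ih ← length-≤-count+count-¬ xs | P? x
  ... | yes _ = s≤s ih
  ... | no _  = ≤-trans (s≤s ih) (≤-reflexive (sym (+-suc _ _)))

  count-map : (f : B → A) → ∀ xs → count (map f xs) ≡ length (filter (P? ∘ f) xs)
  count-map f [] = refl
  count-map f (x ∷ xs) with P? (f x)
  ... | yes _ = cong suc (count-map f xs)
  ... | no _  = count-map f xs

  count-cons-≤ : ∀ x xs → count (x ∷ xs) ≤ suc (count xs)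
  count-cons-≤ x xs with P? x
  ... | yes _ = ≤-refl
  ... | no _  = n≤1+n _

  -- `count P? [ x ]` serves as the 0-1 indicator of the predicate at `x`.
  count-cons : ∀ x xs → count (x ∷ xs) ≡ count [ x ] + count xs
  count-cons x xs with P? x
  ... | yes _ = refl
  ... | no _  = refl

module _ {P : Pred A p} {Q : Pred A q} (P? : Decidable P) (Q? : Decidable Q) where

  count-mono : P ⊆ Q → ∀ xs → count P? xs ≤ count Q? xs
  count-mono P⊆Q xs =
    length-mono-≤ (filter⁺ (setoid A) P? Q? (λ { refl → P⊆Q }) (⊆-refl {x = xs}))

  count-mono-< : P ⊆ Q → ∀ {xs} → Any (λ x → Q x × ¬ P x) xs → count P? xs < count Q? xs
  count-mono-< P⊆Q {x ∷ xs} (here (Qx , ¬Px)) with P? x | Q? x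
  ... | yes Px | _      = contradiction Px ¬Px
  ... | no _   | yes _  = s≤s (count-mono P⊆Q xs)
  ... | no _   | no ¬Qx = contradiction Qx ¬Qx
  count-mono-< P⊆Q {x ∷ xs} (there any) with ih ← count-mono-< P⊆Q any | P? x | Q? x
  ... | yes _  | yes _  = s≤s ih
  ... | yes Px | no ¬Qx = contradiction (P⊆Q Px) ¬Qx
  ... | no _   | yes _  = m<n⇒m<1+n ih
  ... | no _   | no _   = ih

  module _ {R : Pred A r} (R? : Decidable R) where

    count-cover : (∀ {x} → P x → Q x ⊎ R x) → ∀ xs → count P? xs ≤ count Q? xs + count R? xs
    count-cover cover [] = z≤n
    count-cover cover (x ∷ xs) with ih ← count-cover cover xs | P? x | Q? x | R? x
    ... | yes _  | yes _  | yes _  = s≤s (≤-trans ih (+-monoʳ-≤ _ (n≤1+n _)))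
    ... | yes _  | yes _  | no _   = s≤s ih
    ... | yes _  | no _   | yes _  = ≤-trans (s≤s ih) (≤-reflexive (sym (+-suc _ _)))
    ... | no _   | yes _  | yes _  = m≤n⇒m≤1+n (≤-trans ih (+-monoʳ-≤ _ (n≤1+n _)))
    ... | no _   | yes _  | no _   = m≤n⇒m≤1+n ih
    ... | no _   | no _   | yes _  = ≤-trans ih (+-monoʳ-≤ _ (n≤1+n _))
    ... | no _   | no _   | no _   = ih
    ... | yes Px | no ¬Qx | no ¬Rx with cover Px
    ...   | inj₁ Qx = contradiction Qx ¬Qx
    ...   | inj₂ Rx = contradiction Rx ¬Rx

count-≡-Unique : ∀ {n} (v : Fin n) {xs} → Unique xs → count (_≟ v) xs ≤ 1
count-≡-Unique v [] = z≤n
count-≡-Unique v {x ∷ xs} (x∉xs ∷ unique) with x ≟ v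
... | yes refl = s≤s (≤-reflexive (cong length (filter-none (_≟ v) (All.map (_∘ sym) x∉xs))))
... | no _     = count-≡-Unique v unique

-- No entry of a sorted list is below its head, and prepending a head raises both the index and, by
-- at most one, the count.
count-<-lookup-sorted : ∀ {xs} → AllPairs _≤_ xs → (i : Fin (length xs)) →
                        count (_<? lookup xs i) xs ≤ toℕ i
count-<-lookup-sorted {x ∷ xs} (x≤xs ∷ _) zero =
  ≤-reflexive (cong length (filter-none (_<? x)
    (<-irrefl refl ∷ All.map (λ x≤y y<x → <-irrefl refl (<-≤-trans y<x x≤y)) x≤xs)))
count-<-lookup-sorted {x ∷ xs} (_ ∷ sorted) (suc i) =
  ≤-trans (count-cons-≤ (_<? lookup xs i) x xs) (s≤s (count-<-lookup-sorted sorted i))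

-- Paths

-- The list records the visited vertices in order. Repetitions are allowed; distinctness is imposed
-- on the list separately.
data Path {A : Set a} (R : Rel A r) : A → A → List A → Set (a ⊔ r) where
  stop : ∀ x → Path R x x [ x ]
  _∷_ : ∀ {x y z zs} → R x y → Path R y z zs → Path R x z (x ∷ zs)

-- A path cut in two at a step that satisfies S; the step itself need not satisfy R.
record Cut {A : Set a} (R : Rel A r) (S : Rel A b) (x z : A) (zs : List A) : Set (a ⊔ r ⊔ b) where
  constructor cut
  field
    {w w′}  : A
    {ps qs} : List A
    split   : ps ++ qs ≡ zs
    left    : Path R x w ps
    step    : S w w′
    right   : Path R w′ z qs

module _ {R : Rel A r} where

  extendCut : ∀ {S : Rel A b} {x y z zs} → R x y → Cut R S y z zs → Cut R S x z (x ∷ zs)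
  extendCut Rxy (cut refl left step right) = cut refl (Rxy ∷ left) step right

  join : ∀ {w x y z ps qs} → Path R w x ps → R x y → Path R y z qs → Path R w z (ps ++ qs)
  join (stop _)     Rxy right = Rxy ∷ right
  join (Rwv ∷ left) Rxy right = Rwv ∷ join left Rxy right

  reversePath : Symmetric R → ∀ {x y zs} → Path R x y zs → Path R y x (reverse zs)
  reversePath sym-R (stop x) = stop x
  reversePath sym-R (_∷_ {x} {zs = zs} Rxy path) =
    subst (Path R _ _) (sym (unfold-reverse x zs))
      (join (reversePath sym-R path) (sym-R Rxy) (stop x))

  mapPath : ∀ {S : Rel A b} → (∀ {x y} → R x y → S x y) →
            ∀ {x y zs} → Path R x y zs → Path S x y zs
  mapPath f (stop x)     = stop x
  mapPath f (Rxy ∷ path) = f Rxy ∷ mapPath f path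

  head∈ : ∀ {x y zs} → Path R x y zs → x ∈ zs
  head∈ (stop _) = here refl
  head∈ (_ ∷ _)  = here refl

  last∈ : ∀ {x y zs} → Path R x y zs → y ∈ zs
  last∈ (stop _)   = here refl
  last∈ (_ ∷ path) = there (last∈ path)

  path⇒Linked : ∀ {x y w zs} → Path R x y zs → R y w → Linked R (zs ∷ʳ w)
  path⇒Linked (stop _)             Ryw = Ryw ∷ [-]
  path⇒Linked (Rxz ∷ stop _)       Ryw = Rxz ∷ Ryw ∷ [-]
  path⇒Linked (Rxz ∷ path@(_ ∷ _)) Ryw = Rxz ∷ path⇒Linked path Ryw

  completePath : (∀ {x y} → x ≢ y → R x y) → ∀ x {xs} → Unique (x ∷ xs) →
                 ∃[ y ] Path R x y (x ∷ xs)
  completePath complete x {[]} _ = x , stop x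
  completePath complete x {y ∷ _} ((x≢y ∷ _) ∷ unique) with completePath complete y unique
  ... | z , path = z , complete x≢y ∷ path

module _ {R : Rel A r} {S : Rel A b} where

  -- The cut falls at the first step supplied by `S`; further ones may follow, so the right half
  -- keeps the union relation.
  cutAtUnion : ∀ {x y zs} → Path (λ u v → R u v ⊎ S u v) x y zs →
               Path R x y zs ⊎ Cut (λ u v → R u v ⊎ S u v) S x y zs
  cutAtUnion (stop x) = inj₁ (stop x)
  cutAtUnion (inj₂ Sxy ∷ path) = inj₂ (cut refl (stop _) Sxy path)
  cutAtUnion (inj₁ Rxy ∷ path) with cutAtUnion path
  ... | inj₁ path′ = inj₁ (Rxy ∷ path′)
  ... | inj₂ c     = inj₂ (extendCut (inj₁ Rxy) c)

-- If no step w w′ of the path has P w and Q w′, then the vertices in P, shifted by one step,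
-- are disjoint from those in Q.
module _ {R : Rel A r} {P : Pred A p} {Q : Pred A q} (P? : Decidable P) (Q? : Decidable Q) where

  crossing : ∀ {x y zs} → ¬ P y → Path R x y zs →
             Cut R (λ w w′ → P w × Q w′) x y zs ⊎
             count P? zs + count Q? zs < length zs + count Q? [ x ]
  -- `P` fails at the last vertex, and this supplies the slack of one that makes the bound strict.
  crossing ¬Py (stop y) with P? y
  ... | yes Py = contradiction Py ¬Py
  ... | no _   = inj₂ ≤-refl
  crossing {zs = x ∷ zs} ¬Py (_∷_ {y = z} Rxz path) with crossing ¬Py path
  ... | inj₁ c = inj₁ (extendCut Rxz c)
  ... | inj₂ ih with P? x ×-dec Q? z
  ...   | yes Px×Qz = inj₁ (cut refl (stop x) Px×Qz path)
  ...   | no ¬Px×Qz = inj₂ (begin-strict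
    count P? (x ∷ zs) + count Q? (x ∷ zs)
      ≡⟨ cong₂ _+_ (count-cons P? x zs) (count-cons Q? x zs) ⟩
    (count P? [ x ] + count P? zs) + (count Q? [ x ] + count Q? zs)
      ≡⟨ regroup (count P? [ x ]) (count P? zs) (count Q? [ x ]) (count Q? zs) ⟩
    (count P? [ x ] + count Q? [ x ]) + (count P? zs + count Q? zs)
      <⟨ +-monoʳ-< (count P? [ x ] + count Q? [ x ]) ih ⟩
    (count P? [ x ] + count Q? [ x ]) + (length zs + count Q? [ z ])
      ≡⟨ regroup′ (count P? [ x ]) (count Q? [ x ]) (length zs) (count Q? [ z ]) ⟩
    (count P? [ x ] + count Q? [ z ]) + (length zs + count Q? [ x ])
      ≤⟨ +-monoˡ-≤ _ not-both ⟩
    suc (length zs + count Q? [ x ]) ∎)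
    where
    open ≤-Reasoning
    regroup : ∀ i j k l → (i + j) + (k + l) ≡ (i + k) + (j + l)
    regroup = solve-∀
    regroup′ : ∀ i j k l → (i + j) + (k + l) ≡ (i + l) + (k + j)
    regroup′ = solve-∀
    -- Without a crossing at the step from `x` to `z` at most one indicator is 1, which the new
    -- vertex pays for in the length.
    not-both : count P? [ x ] + count Q? [ z ] ≤ 1
    not-both with P? x | Q? z
    ... | yes Px | yes Qz = contradiction (Px , Qz) ¬Px×Qz
    ... | yes _  | no _   = ≤-refl
    ... | no _   | yes _  = ≤-refl
    ... | no _   | no _   = z≤n

-- Hamilton cycles and the Bondy-Chvátal closure step

Joins : ∀ {n} (u v : Fin n) → Rel (Fin n) 0ℓ
Joins u v x y = (x ≡ u × y ≡ v) ⊎ (x ≡ v × y ≡ u)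

module _ {n} {R : Rel (Fin n) 0ℓ} {u v : Fin n} where

  -- Every added step has `u` as an endpoint.
  avoidEndpoint : ∀ {x y zs} → u ∉ zs → Path (λ a b → R a b ⊎ Joins u v a b) x y zs → Path R x y zs
  avoidEndpoint _ (stop x) = stop x
  avoidEndpoint u∉ (inj₁ Rxy ∷ path) = Rxy ∷ avoidEndpoint (u∉ ∘ there) path
  avoidEndpoint u∉ (inj₂ (inj₁ (refl , _)) ∷ _) = contradiction (here refl) u∉
  avoidEndpoint u∉ (inj₂ (inj₂ (_ , refl)) ∷ path) = contradiction (there (head∈ path)) u∉

  -- Since `u` occurs only at the start, only the first step could be the added edge. It would lead
  -- to `v`, which is also the last vertex, so with at least three vertices `v` would occur twice.
  spanningAvoidsEdge : ∀ {zs} → Unique zs → 3 ≤ length zs →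
                       Path (λ a b → R a b ⊎ Joins u v a b) u v zs → Path R u v zs
  spanningAvoidsEdge (u∉ ∷ unique) (s≤s 2≤) (step ∷ path) =
    first u∉zs unique 2≤ step path ∷ avoidEndpoint u∉zs path
    where
    u∉zs = λ u∈ → All.lookup u∉ u∈ refl
    first : ∀ {y zs} → u ∉ zs → Unique zs → 2 ≤ length zs → R u y ⊎ Joins u v u y →
            Path (λ a b → R a b ⊎ Joins u v a b) y v zs → R u y
    first _ _ _ (inj₁ Ruy) _ = Ruy
    first u∉zs _ _ (inj₂ (inj₂ (_ , refl))) path = contradiction (head∈ path) u∉zs
    first _ _ (s≤s ()) (inj₂ (inj₁ _)) (stop _)
    first _ (v∉ ∷ _) _ (inj₂ (inj₁ (_ , refl))) (_ ∷ path) =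
      contradiction refl (All.lookup v∉ (last∈ path))

-- Being a permutation of `allFin n` gives distinctness and spanning at once, and survives the
-- reversals and rotations below.
record HamiltonCycle {n} (R : Rel (Fin n) 0ℓ) : Set where
  constructor hamiltonCycle
  field
    {x y}    : Fin n
    {zs}     : List (Fin n)
    path     : Path R x y zs
    closing  : R y x
    spanning : zs ↭ allFin n

spanning⇒Unique : ∀ {n} {zs : List (Fin n)} → zs ↭ allFin n → Unique zs
spanning⇒Unique {n} zs↭ = Unique-resp-↭ (setoid (Fin n)) (↭⇒↭ₛ (↭-sym zs↭)) (allFin⁺ n)

spanning⇒length : ∀ {n} {zs : List (Fin n)} → zs ↭ allFin n → length zs ≡ n
spanning⇒length zs↭ = trans (↭-length zs↭) (length-tabulate id)

module _ {n} {G : Graph n} where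
  open Graph G

  HamiltonCycle⇒Hamiltonian : 3 ≤ n → HamiltonCycle Adj → Hamiltonian G
  HamiltonCycle⇒Hamiltonian 3≤n (hamiltonCycle path closing spanning) = go path closing spanning
    where
    go : ∀ {x y zs} → Path Adj x y zs → Adj y x → zs ↭ allFin n → Hamiltonian G
    go {x} {zs = z ∷ zs} path closing spanning = record
      { first    = z
      ; rest     = zs
      ; long     = ≤-trans 3≤n (≤-reflexive (sym (spanning⇒length spanning)))
      ; simple   = spanning⇒Unique spanning
      ; adjacent = path⇒Linked path (subst (Adj _) (starts path) closing)
      } , λ v → ∈-resp-↭ (↭-sym spanning) (∈-allFin v)
      where
      starts : ∀ {x y z zs} → Path Adj x y (z ∷ zs) → x ≡ z
      starts (stop _) = refl
      starts (_ ∷ _)  = refl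

  complete⇒HamiltonCycle : 3 ≤ n → (∀ {x y} → x ≢ y → Adj x y) → HamiltonCycle Adj
  -- Exposing two successors makes `allFin n` reduce to a list with at least two entries, so the
  -- path has a step and ends in the tail, away from `zero`.
  complete⇒HamiltonCycle (s≤s (s≤s _)) complete with completePath complete zero (allFin⁺ n)
  ... | _ , path@(_ ∷ path′) = hamiltonCycle path (complete y≢0) (↭-reflexive refl)
    where
    y≢0 : _ ≢ zero
    y≢0 y≡0 with allFin⁺ n
    ... | 0∉ ∷ _ = All.lookup 0∉ (last∈ path′) (sym y≡0)

  -- Ore's crossing argument: w ~ y and x ~ w′ for some step w w′ of the path.
  closePath : ∀ {x y zs} → Path Adj x y zs → zs ↭ allFin n → n ≤ degree G x + degree G y →
              HamiltonCycle Adj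
  closePath {x} {y} {zs} path spanning n≤
    with crossing (adj? y) (adj? x) (irrefl refl) path
  ... | inj₁ (cut {ps = ps} {qs} split left (Ayw , Axw′) right) =
    -- The new cycle runs from `x` to `w`, jumps to `y`, returns backwards to `w′` and closes with
    -- the edge from `w′` to `x`.
    hamiltonCycle (join left (symm Ayw) (reversePath symm right)) (symm Axw′)
      (↭-trans (++⁺ˡ ps (↭-reverse qs)) (↭-trans (↭-reflexive split) spanning))
  ... | inj₂ few = contradiction n≤ (<⇒≱ (begin-strict
    degree G x + degree G y                   ≡⟨ +-comm (degree G x) (degree G y) ⟩
    degree G y + degree G x                   ≡⟨ cong₂ _+_ (count-↭ (adj? y) spanning)
                                                          (count-↭ (adj? x) spanning) ⟨
    count (adj? y) zs + count (adj? x) zs     <⟨ few ⟩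
    length zs + count (adj? x) [ x ]          ≡⟨ cong (λ ws → length zs + length ws)
                                                       (filter-none (adj? x) (irrefl refl ∷ [])) ⟩
    length zs + 0                             ≡⟨ +-identityʳ _ ⟩
    length zs                                 ≡⟨ spanning⇒length spanning ⟩
    n ∎))
    where open ≤-Reasoning

module _ {n} (G : Graph n) {u v : Fin n} (u≢v : u ≢ v) where
  open Graph G

  addEdge : Graph n
  addEdge = record
    { Adj    = λ x y → Adj x y ⊎ Joins u v x y
    ; adj?   = λ x y → adj? x y ⊎-dec (x ≟ u ×-dec y ≟ v) ⊎-dec (x ≟ v ×-dec y ≟ u)
    ; symm   = λ { (inj₁ Axy)            → inj₁ (symm Axy)
                 ; (inj₂ (inj₁ (x , y))) → inj₂ (inj₂ (y , x))
                 ; (inj₂ (inj₂ (x , y))) → inj₂ (inj₁ (y , x)) }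
    ; irrefl = λ { refl (inj₁ Axx)               → irrefl refl Axx
                 ; refl (inj₂ (inj₁ (x≡u , x≡v))) → u≢v (trans (sym x≡u) x≡v)
                 ; refl (inj₂ (inj₂ (x≡v , x≡u))) → u≢v (trans (sym x≡u) x≡v) }
    }

  -- A cycle through the added edge, opened there, is a Hamilton path of `G` between `u` and `v`,
  -- and `closePath` closes it again. A cycle avoiding that edge already lies in `G`.
  bondy-chvátal : 3 ≤ n → n ≤ degree G u + degree G v →
                  HamiltonCycle (Graph.Adj addEdge) → HamiltonCycle Adj
  bondy-chvátal 3≤n n≤ (hamiltonCycle {x} {y} {zs} path closing spanning) =
    [ rotate , openAt path spanning ]′ closing
    where
    openAt : ∀ {x y zs} → Path (Graph.Adj addEdge) x y zs → zs ↭ allFin n → Joins u v y x →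
             HamiltonCycle Adj
    openAt path spanning joins = closePath {G = G} (unused joins) spanning (large joins)
      where
      3≤length = ≤-trans 3≤n (≤-reflexive (sym (spanning⇒length spanning)))
      unused : Joins u v _ _ → Path Adj _ _ _
      unused (inj₂ (refl , refl)) =
        spanningAvoidsEdge (spanning⇒Unique spanning) 3≤length path
      unused (inj₁ (refl , refl)) =
        spanningAvoidsEdge (spanning⇒Unique spanning) 3≤length
          (mapPath (Sum.map₂ Sum.swap) path)
      large : Joins u v _ _ → n ≤ degree G _ + degree G _
      large (inj₂ (refl , refl)) = n≤
      large (inj₁ (refl , refl)) = ≤-trans n≤ (≤-reflexive (+-comm (degree G u) _))
    rotate : Adj y x → HamiltonCycle Adj
    rotate Ayx with cutAtUnion path
    ... | inj₁ path′ = hamiltonCycle path′ Ayx spanning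
    ... | inj₂ (cut {ps = ps} {qs} split left joins right) =
      -- Rotating the cycle turns the added edge into the closing one.
      openAt (join right (inj₁ Ayx) left)
        (↭-trans (++-comm qs ps) (↭-trans (↭-reflexive split) spanning)) joins

-- Degrees

below : ∀ {n} → Graph n → ℕ → ℕ
below {n} G t = count (λ w → degree G w <? t) (allFin n)

below-mono : ∀ {n} (G : Graph n) {s t} → s ≤ t → below G s ≤ below G t
below-mono {n} G s≤t = count-mono _ _ (λ w<s → <-≤-trans w<s s≤t) (allFin n)

-- Counting is invariant under sorting, and the `i`-th term stands at position `i` - 1 counted from
-- zero. The rest of the proof knows the degree sequence only through these bounds.
below-d : ∀ {n} (G : Graph n) i .(1≤i : 1 ≤ i) .(i≤n : i ≤ n) → below G (d G i 1≤i i≤n) < i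
below-d {n} G (suc i) 1≤i i<n = s≤s (begin
  below G t                             ≡⟨ count-map (_<? t) (degree G) (allFin n) ⟨
  count (_<? t) (map (degree G) (allFin n))
    ≡⟨ cong (count (_<? t)) (map-tabulate id (degree G)) ⟩
  count (_<? t) (tabulate (degree G))   ≡⟨ count-↭ (_<? t) (Sort.sort-↭ (tabulate (degree G))) ⟨
  count (_<? t) (degreeSequence G)      ≤⟨ count-<-lookup-sorted
                                               (Linked⇒AllPairs ≤-trans (Sort.sort-↗ _)) _ ⟩
  toℕ _                                 ≡⟨ toℕ-fromℕ< _ ⟩
  i ∎)
  where
  open ≤-Reasoning
  t = d G (suc i) 1≤i i<n

minDegree≤degree : ∀ {n} (G : Graph n) (1≤n : 1 ≤ n) v → minDegree G 1≤n ≤ degree G v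
minDegree≤degree {n} G 1≤n v = ≮⇒≥ λ v<δ →
  <⇒≱ (below-d G 1 (s≤s z≤n) 1≤n) (filter-some _ (lose (∈-allFin v) v<δ))

-- N t is the number of vertices of degree below t, and x, y, z are d_δ, d_{δ+1}, d_{δ+2}.
below-arithmetic : (N : ℕ → ℕ) → (∀ {s t} → s ≤ t → N s ≤ N t) →
                   ∀ {n δ k m x y z} → m + k ≡ n → k + k < n → δ ≤ k →
                   N x < δ → N y < δ + 1 → N z < δ + 2 → n ≤ x + z → n ≤ 2 * y →
                   k ≤ N (suc k) → m ≤ N m → ⊥
below-arithmetic N N-mono {δ = δ} {k} {m} {x} {y} {z} refl 2k<n δ≤k Nx Ny Nz n≤x+z n≤2y k≤ m≤ =
  -- Here `m ≤ N m ≤ N y ≤ k`, so `m + k ≤ k + k`, against `2k<n`.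
  <⇒≱ 2k<n (+-monoˡ-≤ k (≤-trans m≤ (≤-trans (N-mono m≤y) Ny≤k)))
  where
  k<y : k < y
  k<y = *-cancelˡ-< 2 k y
    (<-≤-trans (subst (_< m + k) (cong (k +_) (sym (+-identityʳ k))) 2k<n) n≤2y)
  k≡δ : k ≡ δ
  k≡δ = ≤-antisym
    -- `k ≤ N (suc k) ≤ N y ≤ δ`.
    (≤-pred (≤-<-trans (≤-trans k≤ (N-mono k<y)) (subst (N y <_) (+-comm δ 1) Ny))) δ≤k
  Ny≤k : N y ≤ k
  Ny≤k = ≤-pred (subst (N y <_) (trans (+-comm δ 1) (cong suc (sym k≡δ))) Ny)
  x≤k : x ≤ k
  x≤k = ≮⇒≥ λ k<x →
    <⇒≱ Nx (≤-trans (≤-reflexive (sym k≡δ)) (≤-trans k≤ (N-mono k<x)))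
  m≤z : m ≤ z
  m≤z = +-cancelʳ-≤ k m z
    (≤-trans n≤x+z (≤-trans (+-monoˡ-≤ z x≤k) (≤-reflexive (+-comm k z))))
  m≤y : m ≤ y
  -- `m ≤ N m ≤ N z ≤ δ + 1 = k + 1 ≤ y`.
  m≤y = ≤-trans m≤ (≤-trans (N-mono m≤z)
    (≤-trans (≤-pred (subst (N z <_) (trans (+-comm δ 2) (cong (2 +_) (sym k≡δ))) Nz)) k<y))

-- Nonadjacent pairs of maximal degree sum

module _ {n} (G : Graph n) where
  open Graph G

  Nonadjacent : Pred (Fin n × Fin n) 0ℓ
  Nonadjacent (u , v) = u ≢ v × ¬ Adj u v

  nonadjacent? : Decidable Nonadjacent
  nonadjacent? (u , v) = ¬? (u ≟ v) ×-dec ¬? (adj? u v)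

  nonadjacentPairs : List (Fin n × Fin n)
  nonadjacentPairs = filter nonadjacent? (cartesianProduct (allFin n) (allFin n))

  ∈-allPairs : ∀ e → e ∈ cartesianProduct (allFin n) (allFin n)
  ∈-allPairs (u , v) = ∈-cartesianProduct⁺ (∈-allFin u) (∈-allFin v)

  degreeSum : Fin n × Fin n → ℕ
  degreeSum (u , v) = degree G u + degree G v

  complete⊎maximal : (∀ {u v} → u ≢ v → Adj u v) ⊎
                     ∃[ e ] Nonadjacent e × (∀ {e′} → Nonadjacent e′ → degreeSum e′ ≤ degreeSum e)
  complete⊎maximal with nonadjacentPairs in eq
  ... | [] = inj₁ λ {u} {v} u≢v → decidable-stable (adj? u v) λ ¬Auv →
    case subst ((u , v) ∈_) eq (∈-filter⁺ nonadjacent? (∈-allPairs (u , v)) (u≢v , ¬Auv)) of λ ()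
  ... | e ∷ es = inj₂ (argmax degreeSum e es , proj₂ max , proj₁ max)
    where
    all : All Nonadjacent (e ∷ es)
    all = subst (All Nonadjacent) eq (all-filter nonadjacent? (cartesianProduct (allFin n) (allFin n)))
    max : (∀ {e′} → Nonadjacent e′ → degreeSum e′ ≤ degreeSum (argmax degreeSum e es)) ×
          Nonadjacent (argmax degreeSum e es)
    -- `e` is the default value of `argmax`, so its bound comes from a lemma of its own.
    max = (λ {e′} na → All.lookup (f[⊥]≤f[argmax] {f = degreeSum} e es ∷ f[xs]≤f[argmax] e es)
                         (subst (e′ ∈_) eq (∈-filter⁺ nonadjacent? (∈-allPairs e′) na)))
        , argmax-all degreeSum (All.head all) (All.tail all)

  -- The vertices not adjacent to v, other than v, have degree at most deg u, and those not
  -- adjacent to u, including u, have degree at most deg v.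
  maximal⇒below : ∀ {u v} → Nonadjacent (u , v) →
    (∀ {e} → Nonadjacent e → degreeSum e ≤ degreeSum (u , v)) →
    degree G u ≤ degree G v → degree G u + degree G v < n →
    degree G u ≤ below G (suc (degree G u)) × n ∸ degree G u ≤ below G (n ∸ degree G u)
  maximal⇒below {u} {v} (u≢v , ¬Auv) maximal du≤dv sum<n =
    -- The unit removed by `≤-pred` is `v` itself, which is its own nonneighbour.
    +-cancelʳ-≤ (degree G v) _ _ (≤-pred (begin-strict
      degree G u + degree G v                       <⟨ sum<n ⟩
      n                                             ≤⟨ n≤degree+nonneighbours v ⟩
      degree G v + nonneighbours v                  ≤⟨ +-monoʳ-≤ (degree G v)
                                                         (count-cover _ (_≟ v)
                                                           (λ w → degree G w <? suc (degree G u))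
                                                           far-from-v (allFin n)) ⟩
      degree G v + (count (_≟ v) (allFin n) + below G (suc (degree G u)))
                                                    ≤⟨ +-monoʳ-≤ (degree G v)
                                                         (+-monoˡ-≤ _ (count-≡-Unique v (allFin⁺ n))) ⟩
      degree G v + suc (below G (suc (degree G u))) ≡⟨ +-comm (degree G v) _ ⟩
      suc (below G (suc (degree G u)) + degree G v) ∎))
    , (begin
      n ∸ degree G u            ≤⟨ m≤n+o⇒m∸n≤o n (degree G u) (n≤degree+nonneighbours u) ⟩
      nonneighbours u           ≤⟨ count-mono _ _ far-from-u (allFin n) ⟩
      below G (n ∸ degree G u)  ∎)
    where
    open ≤-Reasoning
    nonneighbours : Fin n → ℕ
    nonneighbours w = count (¬? ∘ adj? w) (allFin n)
    n≤degree+nonneighbours : ∀ w → n ≤ degree G w + nonneighbours w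
    n≤degree+nonneighbours w =
      subst (_≤ degree G w + nonneighbours w) (length-tabulate id)
        (length-≤-count+count-¬ (adj? w) (allFin n))
    far-from-v : ∀ {w} → ¬ Adj v w → w ≡ v ⊎ degree G w < suc (degree G u)
    far-from-v {w} ¬Avw with w ≟ v
    ... | yes w≡v = inj₁ w≡v
    ... | no w≢v  = inj₂ (s≤s (+-cancelʳ-≤ (degree G v) _ _ (maximal (w≢v , ¬Avw ∘ symm))))
    far-from-u : ∀ {w} → ¬ Adj u w → degree G w < n ∸ degree G u
    far-from-u {w} ¬Auw = m+n≤o⇒m≤o∸n (suc (degree G w)) (≤-<-trans dw+du≤ sum<n)
      where
      dw+du≤ : degree G w + degree G u ≤ degree G u + degree G v
      dw+du≤ with u ≟ w
      -- `u` is its own nonneighbour; its degree is bounded through `du≤dv` instead of maximality.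
      ... | yes refl = +-monoʳ-≤ _ du≤dv
      ... | no u≢w   = ≤-trans (≤-reflexive (+-comm (degree G w) _)) (maximal (u≢w , ¬Auw))

-- The pair `(u , v)` disappears and none is created; this makes the closure induction terminate.
addEdge-nonadjacentPairs : ∀ {n} (G : Graph n) {u v} (na : Nonadjacent G (u , v)) →
  length (nonadjacentPairs (addEdge G (proj₁ na))) < length (nonadjacentPairs G)
addEdge-nonadjacentPairs G {u} {v} na =
  count-mono-< _ _ (λ (x≢y , ¬A) → x≢y , ¬A ∘ inj₁)
    (lose (∈-allPairs G (u , v)) (na , λ (_ , ¬A) → ¬A (inj₂ (inj₁ (refl , refl)))))

addEdge-degree : ∀ {n} (G : Graph n) {u v} (u≢v : u ≢ v) w →
                 degree G w ≤ degree (addEdge G u≢v) w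
addEdge-degree {n} G u≢v w = count-mono _ _ inj₁ (allFin n)

-- Induction along the closure

module _ {n} (G : Graph n) (3≤n : 3 ≤ n) {δ x y z : ℕ} (δ≤degree : ∀ v → δ ≤ degree G v)
         (below-x : below G x < δ) (below-y : below G y < δ + 1) (below-z : below G z < δ + 2)
         (n≤x+z : n ≤ x + z) (n≤2y : n ≤ 2 * y) where

  -- Degrees only grow from `G` to `H`, so lower bounds on `below H` pass to `below G`, where the
  -- hypotheses on `x`, `y`, `z` contradict them, with `k = degree H u` and `m = n ∸ k`.
  maximal⇒large : ∀ H → (∀ w → degree G w ≤ degree H w) → ∀ {u v} → Nonadjacent H (u , v) →
    (∀ {e} → Nonadjacent H e → degreeSum H e ≤ degreeSum H (u , v)) →
    degree H u ≤ degree H v → n ≤ degree H u + degree H v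
  maximal⇒large H G≤H {u} {v} na maximal du≤dv = ≮⇒≥ λ sum<n →
    let few-u , few-v = maximal⇒below H na maximal du≤dv sum<n
        2du<n         = ≤-<-trans (+-monoʳ-≤ (degree H u) du≤dv) sum<n
    in below-arithmetic (below G) (below-mono G)
         (m∸n+n≡m (≤-trans (m≤m+n (degree H u) (degree H v)) (<⇒≤ sum<n)))
         2du<n (≤-trans (δ≤degree u) (G≤H u))
         below-x below-y below-z n≤x+z n≤2y
         (≤-trans few-u (belowH≤belowG _)) (≤-trans few-v (belowH≤belowG _))
    where
    belowH≤belowG : ∀ t → below H t ≤ below G t
    belowH≤belowG t = count-mono _ _ (λ {w} → ≤-<-trans (G≤H w)) (allFin n)

  -- Edges are added until the graph is complete, while the degree hypotheses stay with the fixed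
  -- `G`; each addition is undone by `bondy-chvátal`.
  supergraph-HamiltonCycle : ∀ H → Acc _<_ (length (nonadjacentPairs H)) →
    (∀ w → degree G w ≤ degree H w) → HamiltonCycle (Graph.Adj H)
  supergraph-HamiltonCycle H (acc rec) G≤H with complete⊎maximal H
  ... | inj₁ complete = complete⇒HamiltonCycle {G = H} 3≤n complete
  ... | inj₂ ((u , v) , na@(u≢v , ¬Auv) , maximal) =
    bondy-chvátal H u≢v 3≤n large
      (supergraph-HamiltonCycle (addEdge H u≢v) (rec (addEdge-nonadjacentPairs H na))
        (λ w → ≤-trans (G≤H w) (addEdge-degree H u≢v w)))
    where
    large : n ≤ degree H u + degree H v
    large with ≤-total (degree H u) (degree H v)
    ... | inj₁ du≤dv = maximal⇒large H G≤H na maximal du≤dv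
    ... | inj₂ dv≤du = subst (n ≤_) (+-comm (degree H v) _)
      (maximal⇒large H G≤H (u≢v ∘ sym , ¬Auv ∘ Graph.symm H)
        (λ na′ → ≤-trans (maximal na′) (≤-reflexive (+-comm (degree H u) _))) dv≤du)

theorem2 :
    (n : ℕ) (G : Graph n) (3≤n : 3 ≤ n) →
    let δ = minDegree G (≤-trans (s≤s z≤n) 3≤n) in
    (1≤δ : 1 ≤ δ) (δ+2≤n : δ + 2 ≤ n) →
    let dδ   = d G δ 1≤δ (≤-trans (m≤m+n δ 2) δ+2≤n)
        dδ+1 = d G (δ + 1) (m≤n+m 1 δ) (≤-trans (+-monoʳ-≤ δ (s≤s z≤n)) δ+2≤n)
        dδ+2 = d G (δ + 2) (m≤n⇒m≤n+o 2 1≤δ) δ+2≤n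
    in n ≤ (dδ + dδ+2) ⊓ (2 * dδ+1) →
    Hamiltonian G
theorem2 n G 3≤n 1≤δ δ+2≤n n≤min =
  HamiltonCycle⇒Hamiltonian 3≤n
    (supergraph-HamiltonCycle G 3≤n (minDegree≤degree G 1≤n)
      (below-d G δ _ _) (below-d G (δ + 1) _ _) (below-d G (δ + 2) _ _)
      (≤-trans n≤min (m⊓n≤m _ _)) (≤-trans n≤min (m⊓n≤n _ _))
      G (<-wellFounded _) (λ _ → ≤-refl))
  where
  1≤n = ≤-trans (s≤s z≤n) 3≤n
  δ = minDegree G 1≤n
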